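{- (1) Let $a$ be a stable natural number. Then there exists $K$ such that for all integers $k\ge K$ and all $\ell\ge 0$, \[\|(a3^k+1)3^\ell\|=\|a\|+3k+3\ell+1.\] (2) Let $a,b$ be natural numbers such that $ab$ is stable and $\|ab\|=\|a\|+\|b\|$. Then there exists $K$ such that for all integers $k\ge K$ and all $\ell\ge 0$, \[\|b(a3^k+1)3^\ell\|=\|a\|+\|b\|+3k+3\ell+1.\] Moreover, in both cases such a $K$ can be computed algorithmically (from $a$, resp. from $a$ and $b$).
   Context: For a natural number $n$, $\|n\|$ denotes its integer complexity: the least number of $1$'s needed to write $n$ using only the constant $1$, addition, multiplication, and parentheses. A natural number $n$ is called stable if $\|3^k n\|=3k+\|n\|$ for every $k\ge 0$. -}

module Defs where

open import Data.Nat using (ℕ; _+_; _*_; _^_; _≤_)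
open import Data.Product using (Σ; _×_)
open import Relation.Binary.PropositionalEquality using (_≡_)

data Expr : Set where
  one  : Expr
  _⊕_  : Expr → Expr → Expr
  _⊗_  : Expr → Expr → Expr

eval : Expr → ℕ
eval one     = 1
eval (e ⊕ f) = eval e + eval f
eval (e ⊗ f) = eval e * eval f

ones : Expr → ℕ
ones one     = 1
ones (e ⊕ f) = ones e + ones f
ones (e ⊗ f) = ones e + ones f

‖_‖≡_ : ℕ → ℕ → Set
‖ n ‖≡ c = Σ Expr (λ e → eval e ≡ n × ones e ≡ c) × (∀ e → eval e ≡ n → c ≤ ones e)

Stable : ℕ → Set
Stable n = ∀ k c → ‖ n ‖≡ c → ‖ 3 ^ k * n ‖≡ (3 * k + c)

{-# OPTIONS --safe #-}
module Submission where

-- Measure an expression with value n and s ones by its defect s − 3 log₃ n. The defect is additive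
-- under products, and it is either 0, for a power of 3 written with threes, or at least that of 2.
-- In a sum of bounded defect the smaller summand is bounded, and if the larger one is much bigger,
-- dropping the smaller summand lowers the defect by a fixed amount. Hence, by induction on the
-- defect, an expression of bounded defect has a value n that is either exactly M 3ʲ or slightly above
-- some N = M 3ʲ that can be written with fewer ones, where M is bounded; since the precision can be
-- chosen as a function of the size of M, two such numbers that are this close must coincide.
-- Apply this to an expression for n = b(a3ᵏ+1)3^ℓ with at most ‖ab‖ + 3k + 3ℓ ones. For large k, n is
-- not M 3ʲ with M bounded, and the only candidate for N is ab3^(k+ℓ), which by stability needs
-- ‖ab‖ + 3k + 3ℓ ones: a contradiction.

open import Defs
open import Data.Nat
  using (ℕ; zero; suc; _+_; _*_; _^_; _∸_; _≤_; _<_; _≤?_; z≤n; s≤s; >-nonZero)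
open import Data.Nat.Divisibility using (_∣_; divides; ∣⇒≤; ∣m+n∣m⇒∣n; ∣n⇒∣m*n)
open import Data.Nat.Properties
open import Data.Nat.Tactic.RingSolver using (solve-∀)
open import Data.Product using (Σ; _×_; _,_; proj₁; proj₂)
open import Data.Sum using (_⊎_; inj₁; inj₂)
open import Relation.Binary.Definitions using (tri<; tri≈; tri>)
open import Relation.Binary.PropositionalEquality
  using (_≡_; refl; sym; trans; cong; cong₂; subst; subst₂)
open import Relation.Nullary using (¬_; yes; no; contradiction)

-- Cubes, powers of 3 and positivity

cube : ℕ → ℕ
cube n = n * n * n

cube-mono : ∀ {m n} → m ≤ n → cube m ≤ cube n
cube-mono m≤n = *-mono-≤ (*-mono-≤ m≤n m≤n) m≤n

cube-* : ∀ m n → cube (m * n) ≡ cube m * cube n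
cube-* = unfolded
  where
  unfolded : ∀ m n → (m * n) * (m * n) * (m * n) ≡ (m * m * m) * (n * n * n)
  unfolded = solve-∀

n≤cube : ∀ n → n ≤ cube n
n≤cube zero = z≤n
n≤cube n@(suc _) = ≤-trans (m≤m*n n n) (m≤m*n (n * n) n)

cube-3^ : ∀ j → cube (3 ^ j) ≡ 3 ^ (3 * j)
cube-3^ j = trans (unfolded (3 ^ j)) (trans (^-*-assoc 3 j 3) (cong (3 ^_) (*-comm j 3)))
  where
  unfolded : ∀ m → m * m * m ≡ m * (m * (m * 1))
  unfolded = solve-∀

eval≥1 : ∀ e → 1 ≤ eval e
eval≥1 one     = ≤-refl
eval≥1 (e ⊕ f) = ≤-trans (eval≥1 e) (m≤m+n _ _)
eval≥1 (e ⊗ f) = *-mono-≤ (eval≥1 e) (eval≥1 f)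

ones≥1 : ∀ e → 1 ≤ ones e
ones≥1 one     = ≤-refl
ones≥1 (e ⊕ f) = ≤-trans (ones≥1 e) (m≤m+n _ _)
ones≥1 (e ⊗ f) = ≤-trans (ones≥1 e) (m≤m+n _ _)

-- The gap between defect 0 and the defect of 2

-- Exponentiating the defect gives 3ˢ / n³, which keeps everything in ℕ; `lossy` says that this
-- ratio is at least 9 / 8, its value at n = s = 2.
data Efficiency (n s : ℕ) : Set where
  power : ∀ j → n ≡ 3 ^ j → s ≡ 3 * j → Efficiency n s
  lossy : 9 * cube n ≤ 8 * 3 ^ s → Efficiency n s

cube≤3^ : ∀ {n s} → Efficiency n s → cube n ≤ 3 ^ s
cube≤3^ (power j refl refl) = ≤-reflexive (cube-3^ j)
cube≤3^ {n} {s} (lossy p) = *-cancelˡ-≤ 9 (≤-trans p (*-monoˡ-≤ (3 ^ s) (n≤1+n 8)))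

two-ones : ∀ {n s} → 2 ≤ n → cube n ≤ 3 ^ s → 2 ≤ s
two-ones {s = zero} 2≤n p = contradiction (≤-trans (cube-mono 2≤n) p) λ { (s≤s ()) }
two-ones {s = suc zero} 2≤n p =
  contradiction (≤-trans (cube-mono 2≤n) p) λ { (s≤s (s≤s (s≤s ()))) }
two-ones {s = suc (suc s)} 2≤n p = s≤s (s≤s z≤n)

*-lossyˡ : ∀ {m n} s t → 9 * cube m ≤ 8 * 3 ^ s → cube n ≤ 3 ^ t →
  9 * cube (m * n) ≤ 8 * 3 ^ (s + t)
*-lossyˡ {m} {n} s t p q = begin
  9 * cube (m * n)        ≡⟨ cong (9 *_) (cube-* m n) ⟩
  9 * (cube m * cube n)   ≡⟨ *-assoc 9 (cube m) (cube n) ⟨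
  9 * cube m * cube n     ≤⟨ *-mono-≤ p q ⟩
  8 * 3 ^ s * 3 ^ t       ≡⟨ *-assoc 8 (3 ^ s) (3 ^ t) ⟩
  8 * (3 ^ s * 3 ^ t)     ≡⟨ cong (8 *_) (^-distribˡ-+-* 3 s t) ⟨
  8 * 3 ^ (s + t)         ∎
  where open ≤-Reasoning

*-efficiency : ∀ {m n s t} →
  Efficiency m s → Efficiency n t → Efficiency (m * n) (s + t)
*-efficiency (power i refl refl) (power j refl refl) =
  power (i + j) (sym (^-distribˡ-+-* 3 i j)) (sym (*-distribˡ-+ 3 i j))
*-efficiency {m} {n} {s} {t} (lossy p) q = lossy (*-lossyˡ {m} {n} s t p (cube≤3^ q))
*-efficiency {m} {n} {s} {t} p (lossy q) =
  lossy (subst₂ (λ u v → 9 * cube u ≤ 8 * 3 ^ v) (*-comm n m) (+-comm t s)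
    (*-lossyˡ {n} {m} t s q (cube≤3^ p)))

-- For `n ≥ 2` the sum is at most 2m and `n` costs two ones: 9 (2m)³ = 8 · 9 m³. For `n = 1` only a
-- factor 3 is gained, which suffices from m = 3 on because 9 (4/3)³ ≤ 24. The sum 2 + 1 with three
-- ones is the case that yields `power`.
+-efficiency : ∀ {m n} s t → 1 ≤ n → n ≤ m → 1 ≤ s → 1 ≤ t →
  cube m ≤ 3 ^ s → cube n ≤ 3 ^ t → Efficiency (m + n) (s + t)
+-efficiency {1} {1} s t _ _ 1≤s 1≤t _ _ =
  lossy (*-monoʳ-≤ 8 (^-monoʳ-≤ 3 {2} (+-mono-≤ 1≤s 1≤t)))
+-efficiency {2} {1} s t _ _ _ 1≤t p _ with m≤n⇒m<n∨m≡n (+-mono-≤ (two-ones ≤-refl p) 1≤t)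
... | inj₂ eq = power 1 refl (sym eq)
... | inj₁ 4≤s+t = lossy (≤-trans (m≤n+m 243 405) (*-monoʳ-≤ 8 (^-monoʳ-≤ 3 4≤s+t)))
+-efficiency {suc (suc (suc m))} {1} s t _ _ _ 1≤t p _ = lossy (begin
  9 * cube (3 + m + 1)     ≤⟨ m≤m+n _ _ ⟩
  9 * cube (3 + m + 1) + (72 + 216 * m + 108 * (m * m) + 15 * cube m) ≡⟨ unfolded m ⟨
  8 * (cube (3 + m) * 3)   ≤⟨ *-monoʳ-≤ 8 (*-mono-≤ p (^-monoʳ-≤ 3 1≤t)) ⟩
  8 * (3 ^ s * 3 ^ t)      ≡⟨ cong (8 *_) (^-distribˡ-+-* 3 s t) ⟨
  8 * 3 ^ (s + t)          ∎)
  where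
  open ≤-Reasoning
  unfolded : ∀ m → 8 * ((3 + m) * (3 + m) * (3 + m) * 3) ≡
    9 * ((3 + m + 1) * (3 + m + 1) * (3 + m + 1)) + (72 + 216 * m + 108 * (m * m) + 15 * (m * m * m))
  unfolded = solve-∀
+-efficiency {m} {n@(suc (suc _))} s t _ n≤m _ _ p q = lossy (begin
  9 * cube (m + n)        ≤⟨ *-monoʳ-≤ 9 (cube-mono (+-monoʳ-≤ m n≤m)) ⟩
  9 * cube (m + m)        ≡⟨ unfolded m ⟩
  8 * (cube m * 9)        ≤⟨ *-monoʳ-≤ 8 (*-mono-≤ p (^-monoʳ-≤ 3 (two-ones {n} {t} (s≤s (s≤s z≤n)) q))) ⟩
  8 * (3 ^ s * 3 ^ t)     ≡⟨ cong (8 *_) (^-distribˡ-+-* 3 s t) ⟨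
  8 * 3 ^ (s + t)         ∎)
  where
  open ≤-Reasoning
  unfolded : ∀ m → 9 * ((m + m) * (m + m) * (m + m)) ≡ 8 * (m * m * m * 9)
  unfolded = solve-∀

efficiency : ∀ e → Efficiency (eval e) (ones e)
efficiency one     = lossy (m≤n+m 9 15)
efficiency (e ⊗ f) = *-efficiency (efficiency e) (efficiency f)
efficiency (e ⊕ f) with ≤-total (eval f) (eval e)
... | inj₁ f≤e = +-efficiency (ones e) (ones f) (eval≥1 f) f≤e (ones≥1 e) (ones≥1 f)
                   (cube≤3^ (efficiency e)) (cube≤3^ (efficiency f))
... | inj₂ e≤f = subst₂ Efficiency (+-comm (eval f) (eval e)) (+-comm (ones f) (ones e))
                   (+-efficiency (ones f) (ones e) (eval≥1 e) e≤f (ones≥1 f) (ones≥1 e)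
                     (cube≤3^ (efficiency f)) (cube≤3^ (efficiency e)))

-- Bounded defect in products and sums

-- In terms of the defect δ(n , s) = s − 3 log₃ n this says δ < d δ(2 , 2), since 3 ^ δ(2 , 2) = 9 / 8.
record Dense (d n s : ℕ) : Set where
  constructor below
  field
    bound : 3 ^ s * 8 ^ d < 9 ^ d * cube n

¬dense-zero : ∀ {n s} → cube n ≤ 3 ^ s → ¬ Dense 0 n s
¬dense-zero {n} {s} p (below q) =
  <⇒≱ (subst₂ _<_ (*-identityʳ (3 ^ s)) (*-identityˡ (cube n)) q) p

dense-*-power : ∀ d {m n} s t → cube n ≡ 3 ^ t → Dense d (m * n) (s + t) → Dense d m s
dense-*-power d {m} {n} s t p (below q) = below (*-cancelʳ-< (3 ^ t) _ _ (begin-strict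
  3 ^ s * 8 ^ d * 3 ^ t       ≡⟨ swap (3 ^ s) (8 ^ d) (3 ^ t) ⟩
  3 ^ s * 3 ^ t * 8 ^ d       ≡⟨ cong (_* 8 ^ d) (^-distribˡ-+-* 3 s t) ⟨
  3 ^ (s + t) * 8 ^ d         <⟨ q ⟩
  9 ^ d * cube (m * n)        ≡⟨ cong (9 ^ d *_) (cube-* m n) ⟩
  9 ^ d * (cube m * cube n)   ≡⟨ *-assoc (9 ^ d) (cube m) (cube n) ⟨
  9 ^ d * cube m * cube n     ≡⟨ cong (9 ^ d * cube m *_) p ⟩
  9 ^ d * cube m * 3 ^ t      ∎))
  where
  open ≤-Reasoning
  swap : ∀ a b c → a * b * c ≡ a * c * b
  swap = solve-∀

-- Defects add, and a lossy factor accounts for at least one unit δ(2 , 2), which its cofactor no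
-- longer has.
dense-*-lossy : ∀ d {m n} s t → 9 * cube n ≤ 8 * 3 ^ t →
  Dense (suc d) (m * n) (s + t) → Dense d m s
dense-*-lossy d {m} {n} s t p (below q) = below (*-cancelʳ-< (9 * cube n) _ _ (begin-strict
  3 ^ s * 8 ^ d * (9 * cube n)    ≤⟨ *-monoʳ-≤ (3 ^ s * 8 ^ d) p ⟩
  3 ^ s * 8 ^ d * (8 * 3 ^ t)     ≡⟨ regroup (3 ^ s) (8 ^ d) 8 (3 ^ t) ⟩
  3 ^ s * 3 ^ t * 8 ^ suc d       ≡⟨ cong (_* 8 ^ suc d) (^-distribˡ-+-* 3 s t) ⟨
  3 ^ (s + t) * 8 ^ suc d         <⟨ q ⟩
  9 ^ suc d * cube (m * n)        ≡⟨ cong (9 ^ suc d *_) (cube-* m n) ⟩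
  9 ^ suc d * (cube m * cube n)   ≡⟨ regroup′ 9 (9 ^ d) (cube m) (cube n) ⟩
  9 ^ d * cube m * (9 * cube n)   ∎))
  where
  open ≤-Reasoning
  regroup : ∀ a b c e → a * b * (c * e) ≡ a * e * (c * b)
  regroup = solve-∀
  regroup′ : ∀ a b c e → a * b * (c * e) ≡ b * c * (a * e)
  regroup′ = solve-∀

-- Neither summand has negative defect and m + n ≤ 2m, so density bounds m³n³ by a constant times
-- m³; cancelling m³ bounds n.
dense-+-bound : ∀ d {m n} s t → 1 ≤ m → n ≤ m → cube m ≤ 3 ^ s → cube n ≤ 3 ^ t →
  Dense d (m + n) (s + t) → n ≤ 8 * 9 ^ d
dense-+-bound d {m@(suc _)} {n} s t _ n≤m p q (below r) = begin
  n               ≤⟨ n≤cube n ⟩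
  cube n          ≤⟨ m≤m*n (cube n) (8 ^ d) {{m^n≢0 8 d}} ⟩
  cube n * 8 ^ d  ≤⟨ <⇒≤ (*-cancelˡ-< (cube m) _ _ cancelled) ⟩
  8 * 9 ^ d       ∎
  where
  open ≤-Reasoning
  doubled : ∀ a m → a * ((m + m) * (m + m) * (m + m)) ≡ m * m * m * (8 * a)
  doubled = solve-∀
  cancelled : cube m * (cube n * 8 ^ d) < cube m * (8 * 9 ^ d)
  cancelled = begin-strict
    cube m * (cube n * 8 ^ d)   ≡⟨ *-assoc (cube m) (cube n) (8 ^ d) ⟨
    cube m * cube n * 8 ^ d     ≤⟨ *-monoˡ-≤ (8 ^ d) (*-mono-≤ p q) ⟩
    3 ^ s * 3 ^ t * 8 ^ d       ≡⟨ cong (_* 8 ^ d) (^-distribˡ-+-* 3 s t) ⟨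
    3 ^ (s + t) * 8 ^ d         <⟨ r ⟩
    9 ^ d * cube (m + n)        ≤⟨ *-monoʳ-≤ (9 ^ d) (cube-mono (+-monoʳ-≤ m n≤m)) ⟩
    9 ^ d * cube (m + m)        ≡⟨ doubled (9 ^ d) m ⟩
    cube m * (8 * 9 ^ d)        ∎

-- Dropping `n` shrinks the cubed value at most by (4/3)³ and the power of 3 at least by 3. As 64 /
-- 81 ≤ 8 / 9, the defect falls by a full unit; cleared of denominators this is `24 * 24 ≤ 27 * 24`.
dense-+-drop : ∀ d {m n} s t → 3 * n ≤ m → 1 ≤ t →
  Dense (suc d) (m + n) (s + t) → Dense d m s
dense-+-drop d {m} {n} s t 3n≤m 1≤t (below q) = below (*-cancelʳ-< (27 * 24) _ _ (begin-strict
  3 ^ s * 8 ^ d * (27 * 24)                ≡⟨ regroup (3 ^ s) (8 ^ d) ⟩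
  27 * (3 ^ s * 3 * 8 ^ suc d)             ≤⟨ *-monoʳ-≤ 27 (*-monoˡ-≤ (8 ^ suc d)
                                                (*-monoʳ-≤ (3 ^ s) (^-monoʳ-≤ 3 1≤t))) ⟩
  27 * (3 ^ s * 3 ^ t * 8 ^ suc d)         ≡⟨ cong (λ u → 27 * (u * 8 ^ suc d)) (^-distribˡ-+-* 3 s t) ⟨
  27 * (3 ^ (s + t) * 8 ^ suc d)           <⟨ *-monoʳ-< 27 q ⟩
  27 * (9 ^ suc d * cube (m + n))          ≡⟨ tripled (9 ^ suc d) (m + n) ⟩
  9 ^ suc d * cube (3 * (m + n))           ≤⟨ *-monoʳ-≤ (9 ^ suc d) (cube-mono 3[m+n]≤4m) ⟩
  9 ^ suc d * cube (4 * m)                 ≡⟨ quadrupled (9 ^ d) m ⟩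
  9 ^ d * cube m * (24 * 24)               ≤⟨ *-monoʳ-≤ (9 ^ d * cube m) (*-monoˡ-≤ 24 (m≤n+m 24 3)) ⟩
  9 ^ d * cube m * (27 * 24)               ∎))
  where
  open ≤-Reasoning
  regroup : ∀ a b → a * b * (27 * 24) ≡ 27 * (a * 3 * (8 * b))
  regroup = solve-∀
  tripled : ∀ a k → 27 * (a * (k * k * k)) ≡ a * (3 * k * (3 * k) * (3 * k))
  tripled = solve-∀
  quadrupled : ∀ a m → 9 * a * (4 * m * (4 * m) * (4 * m)) ≡ a * (m * m * m) * (24 * 24)
  quadrupled = solve-∀
  3[m+n]≤4m : 3 * (m + n) ≤ 4 * m
  3[m+n]≤4m = begin
    3 * (m + n)      ≡⟨ *-distribˡ-+ 3 m n ⟩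
    3 * m + 3 * n    ≤⟨ +-monoʳ-≤ (3 * m) 3n≤m ⟩
    3 * m + m        ≡⟨ +-comm (3 * m) m ⟩
    4 * m            ∎

-- Approximation by cheap numbers M 3ʲ

-- N = eval expr = M 3ʲ is a lower approximation of n whose relative error is below 1 / F T, where
-- T bounds M: the precision may be demanded as an arbitrary function of the size of M.
record Approx (F : ℕ → ℕ) (B n s : ℕ) : Set where
  field
    T M j x : ℕ
    expr    : Expr
    T≤B     : T ≤ B
    M≤T     : M ≤ T
    value   : eval expr ≡ M * 3 ^ j
    excess  : n ≡ eval expr + x
    small   : suc (F T) * x ≤ eval expr
    cost    : ones expr ≤ s
    saving  : x ≡ 0 ⊎ ones expr < s

open Approx

exact : ∀ {F B} e → eval e ≤ B → Approx F B (eval e) (ones e)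
exact {F} e n≤B = record
  { T = eval e ; M = eval e ; j = 0 ; x = 0 ; expr = e
  ; T≤B = n≤B ; M≤T = ≤-refl
  ; value = sym (*-identityʳ (eval e))
  ; excess = sym (+-identityʳ (eval e))
  ; small = ≤-trans (≤-reflexive (*-zeroʳ (suc (F (eval e))))) z≤n
  ; cost = ≤-refl ; saving = inj₁ refl
  }

-- The power of 3 goes into the exponent `j`, so `T` and `B` do not grow, however many such factors
-- are split off.
scale : ∀ {F B n s} j f → eval f ≡ 3 ^ j → Approx F B n s →
  Approx F B (n * eval f) (s + ones f)
scale {F} {B} {n} {s} i f f≡3^i a = record
  { T = T a ; M = M a ; j = j a + i ; x = x a * v ; expr = expr a ⊗ f
  ; T≤B = T≤B a ; M≤T = M≤T a
  ; value = begin-equality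
      eval (expr a) * v             ≡⟨ cong₂ _*_ (value a) f≡3^i ⟩
      M a * 3 ^ j a * 3 ^ i      ≡⟨ *-assoc (M a) (3 ^ j a) (3 ^ i) ⟩
      M a * (3 ^ j a * 3 ^ i)    ≡⟨ cong (M a *_) (^-distribˡ-+-* 3 (j a) i) ⟨
      M a * 3 ^ (j a + i)        ∎
  ; excess = trans (cong (_* v) (excess a)) (*-distribʳ-+ v (eval (expr a)) (x a))
  ; small = begin
      suc (F (T a)) * (x a * v)  ≡⟨ *-assoc (suc (F (T a))) (x a) v ⟨
      suc (F (T a)) * x a * v    ≤⟨ *-monoˡ-≤ v (small a) ⟩
      eval (expr a) * v             ∎
  ; cost = +-monoˡ-≤ (ones f) (cost a)
  ; saving = saved (saving a)
  }
  where
  open ≤-Reasoning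
  v = eval f
  saved : x a ≡ 0 ⊎ ones (expr a) < s → x a * v ≡ 0 ⊎ ones (expr a) + ones f < s + ones f
  saved (inj₁ x≡0) = inj₁ (cong (_* v) x≡0)
  saved (inj₂ lt)  = inj₂ (+-monoˡ-< (ones f) lt)

-- Each of the error terms `u * y`, `w * v`, `w * y` may use a third of the allowed error, so both
-- factors need precision `3 * g`; this is the successor of `2 + 3 * F`.
*-approx : ∀ {F F₁ F₂ B₁ B₂ B m n s t} (a : Approx F₁ B₁ m s) (b : Approx F₂ B₂ n t) →
  T a * T b ≤ B → 2 + 3 * F (T a * T b) ≤ F₁ (T a) → 2 + 3 * F (T a * T b) ≤ F₂ (T b) →
  Approx F B (m * n) (s + t)
*-approx {F} {F₁} {F₂} {m = m} {n} {s} {t} a b T≤ p q = record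
  { T = T a * T b ; M = M a * M b ; j = j a + j b
  ; x = u * y + w * v + w * y
  ; expr = expr a ⊗ expr b
  ; T≤B = T≤ ; M≤T = *-mono-≤ (M≤T a) (M≤T b)
  ; value = begin-equality
      u * v                                  ≡⟨ cong₂ _*_ (value a) (value b) ⟩
      M a * 3 ^ j a * (M b * 3 ^ j b)        ≡⟨ interchange (M a) (3 ^ j a) (M b) (3 ^ j b) ⟩
      M a * M b * (3 ^ j a * 3 ^ j b)        ≡⟨ cong (M a * M b *_) (^-distribˡ-+-* 3 (j a) (j b)) ⟨
      M a * M b * 3 ^ (j a + j b)            ∎
  ; excess = trans (cong₂ _*_ (excess a) (excess b)) (expand u w v y)
  ; small = *-cancelˡ-≤ 3 (begin
      3 * (g * (u * y + w * v + w * y))              ≡⟨ distribute g u w v y ⟩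
      u * (3 * g * y) + 3 * g * w * v + 3 * g * w * y  ≤⟨ +-mono-≤ (+-mono-≤ (*-monoʳ-≤ u 3gy≤v)
                                                          (*-monoˡ-≤ v 3gw≤u)) (*-mono-≤ 3gw≤u y≤v) ⟩
      u * v + u * v + u * v                          ≡⟨ triple (u * v) ⟩
      3 * (u * v)                                    ∎)
  ; cost = +-mono-≤ (cost a) (cost b)
  ; saving = saved (saving a) (saving b)
  }
  where
  open ≤-Reasoning
  u = eval (expr a)
  v = eval (expr b)
  w = x a
  y = x b
  g = suc (F (T a * T b))
  interchange : ∀ a b c e → a * b * (c * e) ≡ a * c * (b * e)
  interchange = solve-∀
  expand : ∀ u w v y → (u + w) * (v + y) ≡ u * v + (u * y + w * v + w * y)
  expand = solve-∀
  distribute : ∀ g u w v y → 3 * (g * (u * y + w * v + w * y)) ≡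
    u * (3 * g * y) + 3 * g * w * v + 3 * g * w * y
  distribute = solve-∀
  triple : ∀ z → z + z + z ≡ 3 * z
  triple = solve-∀
  3g≤ : ∀ {k} → 2 + 3 * F (T a * T b) ≤ k → 3 * g ≤ suc k
  3g≤ h = ≤-trans (≤-reflexive (*-suc 3 (F (T a * T b)))) (s≤s h)
  3gw≤u : 3 * g * w ≤ u
  3gw≤u = ≤-trans (*-monoˡ-≤ w (3g≤ p)) (small a)
  3gy≤v : 3 * g * y ≤ v
  3gy≤v = ≤-trans (*-monoˡ-≤ y (3g≤ q)) (small b)
  y≤v : y ≤ v
  y≤v = ≤-trans (m≤n*m y (suc (F₂ (T b)))) (small b)
  saved : w ≡ 0 ⊎ ones (expr a) < s → y ≡ 0 ⊎ ones (expr b) < t →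
    u * y + w * v + w * y ≡ 0 ⊎ ones (expr a) + ones (expr b) < s + t
  saved (inj₁ w≡0) (inj₁ y≡0) = inj₁ (trans
    (cong₂ (λ w y → u * y + w * v + w * y) w≡0 y≡0)
    (trans (+-identityʳ (u * 0 + 0)) (trans (+-identityʳ (u * 0)) (*-zeroʳ u))))
  saved (inj₁ _) (inj₂ lt) = inj₂ (+-mono-≤-< (cost a) lt)
  saved (inj₂ lt) _        = inj₂ (+-mono-<-≤ lt (cost b))

-- The approximant of the larger summand serves for the sum: `n` joins the error and its ones are
-- saved. Half of the allowed error goes to `x a`, half to `n`; since m + n ≤ 2u + W, the size
-- condition gives 2gW ≤ u.
+-approx : ∀ {F B₁ B m n s t W} (a : Approx (λ T → 1 + 2 * F T) B₁ m s) →
  B₁ ≤ B → n ≤ W → 1 ≤ t → W + 4 * (suc (F (T a)) * W) ≤ m + n → Approx F B (m + n) (s + t)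
+-approx {F} {m = m} {n} {s} {t} {W} a B₁≤B n≤W 1≤t large = record
  { T = T a ; M = M a ; j = j a ; x = x a + n ; expr = expr a
  ; T≤B = ≤-trans (T≤B a) B₁≤B ; M≤T = M≤T a
  ; value = value a
  ; excess = trans (cong (_+ n) (excess a)) (+-assoc u (x a) n)
  ; small = *-cancelˡ-≤ 2 (begin
      2 * (g * (x a + n))         ≡⟨ distribute g (x a) n ⟩
      2 * g * x a + 2 * (g * n)   ≤⟨ +-mono-≤ 2gx≤u 2gn≤u ⟩
      u + u                       ≡⟨ double u ⟩
      2 * u                       ∎)
  ; cost = <⇒≤ lt
  ; saving = inj₂ lt
  }
  where
  open ≤-Reasoning
  u = eval (expr a)
  g = suc (F (T a))
  distribute : ∀ g x n → 2 * (g * (x + n)) ≡ 2 * g * x + 2 * (g * n)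
  distribute = solve-∀
  double : ∀ z → z + z ≡ 2 * z
  double = solve-∀
  quadruple : ∀ z → 2 * (2 * z) ≡ 4 * z
  quadruple = solve-∀
  lt : ones (expr a) < s + t
  lt = ≤-<-trans (cost a) (subst (_≤ s + t) (+-comm s 1) (+-monoʳ-≤ s 1≤t))
  2gx≤u : 2 * g * x a ≤ u
  2gx≤u = ≤-trans (*-monoˡ-≤ (x a) (≤-reflexive (*-suc 2 (F (T a))))) (small a)
  x≤u : x a ≤ u
  x≤u = ≤-trans (m≤n*m (x a) (suc (1 + 2 * F (T a)))) (small a)
  2gn≤u : 2 * (g * n) ≤ u
  2gn≤u = *-cancelˡ-≤ 2 (+-cancelˡ-≤ W _ _ (begin
    W + 2 * (2 * (g * n))   ≡⟨ cong (W +_) (quadruple (g * n)) ⟩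
    W + 4 * (g * n)         ≤⟨ +-monoʳ-≤ W (*-monoʳ-≤ 4 (*-monoʳ-≤ g n≤W)) ⟩
    W + 4 * (g * W)         ≤⟨ large ⟩
    m + n                   ≡⟨ cong (_+ n) (excess a) ⟩
    u + x a + n             ≤⟨ +-mono-≤ (+-monoʳ-≤ u x≤u) n≤W ⟩
    u + u + W               ≡⟨ cong (_+ W) (double u) ⟩
    2 * u + W               ≡⟨ +-comm (2 * u) W ⟩
    W + 2 * u               ∎))

-- Induction on the defect bound

-- Bounds a possibly non-monotone `f` on all arguments up to `n`, for scales `T` of which only an
-- upper bound is known.
total : (ℕ → ℕ) → ℕ → ℕ
total f zero    = f 0
total f (suc n) = total f n + f (suc n)

≤total : ∀ f {t n} → t ≤ n → f t ≤ total f n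
≤total f {n = zero} z≤n = ≤-refl
≤total f {n = suc n} t≤1+n with m≤n⇒m<n∨m≡n t≤1+n
... | inj₁ (s≤s t≤n) = ≤-trans (≤total f t≤n) (m≤m+n _ _)
... | inj₂ refl      = m≤n+m _ _

-- `B` is computed from `d` and `F` before `e` is given; this uniformity allows a threshold
-- independent of `k` and `ℓ`.
Approximable : ℕ → Set
Approximable d = ∀ F → Σ ℕ λ B → ∀ e → Dense d (eval e) (ones e) → Approx F B (eval e) (ones e)

-- The precision for the first factor must anticipate the scale T₂ that the second one will have,
-- while the second one is approximated only once the scale T₁ of the first is known.
*-step : ∀ {d} → Approximable d → ∀ F → Σ ℕ λ B → ∀ e f →
  Dense d (eval e) (ones e) → Dense d (eval f) (ones f) →
  Approx F B (eval e * eval f) (ones e + ones f)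
*-step ih F = total (λ T₁ → T₁ * proj₁ (second T₁)) (proj₁ first) , λ e f p q →
  let a = proj₂ first e p
      b = proj₂ (second (T a)) f q
  in *-approx a b
       (≤-trans (*-monoʳ-≤ (T a) (T≤B b)) (≤total (λ T₁ → T₁ * proj₁ (second T₁)) (T≤B a)))
       (≤total (F₂ (T a)) (T≤B b))
       ≤-refl
  where
  F₂ : ℕ → ℕ → ℕ
  F₂ T₁ T₂ = 2 + 3 * F (T₁ * T₂)
  second = λ T₁ → ih (F₂ T₁)
  first = ih (λ T₁ → total (F₂ T₁) (proj₁ (second T₁)))

+-step : ∀ {d} → Approximable d → ∀ F → Σ ℕ λ B → ∀ e f → eval f ≤ eval e → B ≤ eval e + eval f →
  Dense (suc d) (eval e + eval f) (ones e + ones f) →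
  Approx F B (eval e + eval f) (ones e + ones f)
+-step {d} ih F = B , λ e f f≤e large dense →
  let f≤W = dense-+-bound (suc d) (ones e) (ones f) (eval≥1 e) f≤e
              (cube≤3^ (efficiency e)) (cube≤3^ (efficiency f)) dense
      3f≤e = +-cancelʳ-≤ (eval f) _ _ (begin
        3 * eval f + eval f   ≡⟨ +-comm (3 * eval f) (eval f) ⟩
        4 * eval f            ≤⟨ *-monoʳ-≤ 4 f≤W ⟩
        4 * W                 ≤⟨ m≤n+m (4 * W) (B₁ + (W + 4 * (G * W))) ⟩
        B                     ≤⟨ large ⟩
        eval e + eval f       ∎)
      a = proj₂ rest e (dense-+-drop d (ones e) (ones f) 3f≤e (ones≥1 f) dense)
  in +-approx {W = W} a (≤-trans (m≤m+n B₁ (W + 4 * (G * W))) (m≤m+n _ (4 * W))) f≤W (ones≥1 f) (begin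
       W + 4 * (suc (F (T a)) * W)   ≤⟨ +-monoʳ-≤ W (*-monoʳ-≤ 4 (*-monoˡ-≤ W
                                           (≤total (λ T → suc (F T)) (T≤B a)))) ⟩
       W + 4 * (G * W)               ≤⟨ m≤n+m _ B₁ ⟩
       B₁ + (W + 4 * (G * W))        ≤⟨ m≤m+n _ (4 * W) ⟩
       B                             ≤⟨ large ⟩
       eval e + eval f               ∎)
  where
  open ≤-Reasoning
  W = 8 * 9 ^ suc d
  rest = ih (λ T → 1 + 2 * F T)
  B₁ = proj₁ rest
  G = total (λ T → suc (F T)) B₁
  -- `B₁` bounds the scale, the middle term meets the size condition of `+-approx` for every scale
  -- up to `B₁`, and `4 * W` forces `3 * eval f ≤ eval e`.
  B = B₁ + (W + 4 * (G * W)) + 4 * W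

enlarge : ∀ {F B C n s} → B ≤ C → Approx F B n s → Approx F C n s
enlarge B≤C a = record
  { T = T a ; M = M a ; j = j a ; x = x a ; expr = expr a
  ; T≤B = ≤-trans (T≤B a) B≤C ; M≤T = M≤T a
  ; value = value a ; excess = excess a ; small = small a ; cost = cost a ; saving = saving a
  }

-- Induction on `d`, and for fixed `d` recursion on the expression: a power of 3 as a factor leaves
-- `d` unchanged. At `d = 0` the defect would be negative.
approximable : ∀ d → Approximable d
approximable zero F = 0 , λ e dense →
  contradiction dense (¬dense-zero (cube≤3^ (efficiency e)))
approximable (suc d) F = B , go
  where
  products = *-step {d} (approximable d) F
  sums = +-step {d} (approximable d) F
  -- The summand 1 lets `one` count as exact.
  B = proj₁ products + (1 + proj₁ sums)

  sum≤B : proj₁ sums ≤ B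
  sum≤B = ≤-trans (n≤1+n _) (m≤n+m (1 + proj₁ sums) (proj₁ products))

  sum : ∀ e f → ¬ (eval e + eval f ≤ B) → eval f ≤ eval e →
    Dense (suc d) (eval e + eval f) (ones e + ones f) →
    Approx F B (eval e + eval f) (ones e + ones f)
  sum e f n≰B f≤e dense =
    enlarge sum≤B (proj₂ sums e f f≤e (≤-trans sum≤B (<⇒≤ (≰⇒> n≰B))) dense)

  go : ∀ e → Dense (suc d) (eval e) (ones e) → Approx F B (eval e) (ones e)
  go one _ = exact one (≤-trans (s≤s z≤n) (m≤n+m (1 + proj₁ sums) (proj₁ products)))
  go (e ⊕ f) dense with eval e + eval f ≤? B
  ... | yes n≤B = exact (e ⊕ f) n≤B
  ... | no n≰B with ≤-total (eval f) (eval e)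
  ...   | inj₁ f≤e = sum e f n≰B f≤e dense
  ...   | inj₂ e≤f = subst₂ (Approx F B) (+-comm (eval f) (eval e)) (+-comm (ones f) (ones e))
    (sum f e (λ n≤B → n≰B (subst (_≤ B) (+-comm (eval f) (eval e)) n≤B)) e≤f
      (subst₂ (Dense (suc d)) (+-comm (eval e) (eval f)) (+-comm (ones e) (ones f)) dense))
  go (e ⊗ f) dense with efficiency e | efficiency f
  ... | _ | power j f≡ ones≡ = scale j f f≡ (go e (dense-*-power (suc d) (ones e) (ones f)
    (trans (cong cube f≡) (trans (cube-3^ j) (cong (3 ^_) (sym ones≡)))) dense))
  ... | power j e≡ ones≡ | lossy _ =
    subst₂ (Approx F B) (*-comm (eval f) (eval e)) (+-comm (ones f) (ones e))
      (scale j e e≡ (go f (dense-*-power (suc d) (ones f) (ones e)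
        (trans (cong cube e≡) (trans (cube-3^ j) (cong (3 ^_) (sym ones≡)))) dense′)))
    where
    dense′ = subst₂ (Dense (suc d)) (*-comm (eval e) (eval f)) (+-comm (ones e) (ones f)) dense
  -- Each lossy factor takes one unit of defect from the other, so both fall under the induction
  -- hypothesis for `d`.
  ... | lossy p | lossy q = enlarge (m≤m+n (proj₁ products) (1 + proj₁ sums)) (proj₂ products e f
    (dense-*-lossy d (ones e) (ones f) q dense)
    (dense-*-lossy d (ones f) (ones e) p dense′))
    where
    dense′ = subst₂ (Dense (suc d)) (*-comm (eval e) (eval f)) (+-comm (ones e) (ones f)) dense

-- Growth estimates and divisibility by powers of 3

n<3^n : ∀ n → n < 3 ^ n
n<3^n zero    = s≤s z≤n
n<3^n (suc n) = ≤-trans (s≤s (n<3^n n))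
  (≤-trans (+-monoˡ-≤ (3 ^ n) (m^n>0 3 n)) (+-monoʳ-≤ (3 ^ n) (m≤m+n (3 ^ n) _)))

-- Bernoulli's inequality 1 + d / 8 ≤ (9 / 8)ᵈ, cleared of denominators.
[8+d]8^d≤8*9^d : ∀ d → (8 + d) * 8 ^ d ≤ 8 * 9 ^ d
[8+d]8^d≤8*9^d zero    = ≤-refl
[8+d]8^d≤8*9^d (suc d) = begin
  (8 + suc d) * (8 * 8 ^ d)                ≤⟨ m≤m+n _ (d * 8 ^ d) ⟩
  (8 + suc d) * (8 * 8 ^ d) + d * 8 ^ d    ≡⟨ regroup d (8 ^ d) ⟩
  9 * ((8 + d) * 8 ^ d)                    ≤⟨ *-monoʳ-≤ 9 ([8+d]8^d≤8*9^d d) ⟩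
  9 * (8 * 9 ^ d)                          ≡⟨ swap (9 ^ d) ⟩
  8 * (9 * 9 ^ d)                          ∎
  where
  open ≤-Reasoning
  regroup : ∀ d t → (9 + d) * (8 * t) + d * t ≡ 9 * ((8 + d) * t)
  regroup = solve-∀
  swap : ∀ t → 9 * (8 * t) ≡ 8 * (9 * t)
  swap = solve-∀

c8^8c<9^8c : ∀ c → c * 8 ^ (8 * c) < 9 ^ (8 * c)
c8^8c<9^8c c = *-cancelˡ-< 8 _ _ (begin-strict
  8 * (c * 8 ^ (8 * c))     ≡⟨ *-assoc 8 c (8 ^ (8 * c)) ⟨
  8 * c * 8 ^ (8 * c)       <⟨ *-monoˡ-< (8 ^ (8 * c)) {{m^n≢0 8 (8 * c)}} (m<n+m (8 * c) {8} (s≤s z≤n)) ⟩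
  (8 + 8 * c) * 8 ^ (8 * c) ≤⟨ [8+d]8^d≤8*9^d (8 * c) ⟩
  8 * 9 ^ (8 * c)           ∎)
  where open ≤-Reasoning

gap : ∀ {t u v} → t ∣ u → t ∣ v → u < v → u + t ≤ v
gap {t} (divides p refl) (divides q refl) u<v =
  ≤-trans (≤-reflexive (+-comm (p * t) t)) (*-monoˡ-≤ t (*-cancelʳ-< t p q u<v))

3^∣ : ∀ m {i j} → i ≤ j → 3 ^ i ∣ m * 3 ^ j
3^∣ m {i} {j} i≤j = ∣n⇒∣m*n m (divides (3 ^ (j ∸ i))
  (trans (cong (3 ^_) (sym (m∸n+n≡m i≤j))) (^-distribˡ-+-* 3 (j ∸ i) i)))

-- The hypotheses give 3ˢ / n³ ≤ 3ᶜ, whatever `r` is, and `8 * 3 ^ c` units suffice because (9 /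
-- 8)^(8u) > u.
dense-above : ∀ c {r n s} → 3 ^ r ≤ n → s ≤ c + 3 * r → Dense (8 * 3 ^ c) n s
dense-above c {r} {n} {s} 3^r≤n s≤ = below (begin-strict
  3 ^ s * 8 ^ d                     ≤⟨ *-monoˡ-≤ (8 ^ d) (^-monoʳ-≤ 3 s≤) ⟩
  3 ^ (c + 3 * r) * 8 ^ d           ≡⟨ cong (_* 8 ^ d) (^-distribˡ-+-* 3 c (3 * r)) ⟩
  3 ^ c * 3 ^ (3 * r) * 8 ^ d       ≡⟨ swap (3 ^ c) (3 ^ (3 * r)) (8 ^ d) ⟩
  3 ^ c * 8 ^ d * 3 ^ (3 * r)       <⟨ *-monoˡ-< (3 ^ (3 * r)) {{m^n≢0 3 (3 * r)}} (c8^8c<9^8c (3 ^ c)) ⟩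
  9 ^ d * 3 ^ (3 * r)               ≡⟨ cong (9 ^ d *_) (cube-3^ r) ⟨
  9 ^ d * cube (3 ^ r)              ≤⟨ *-monoʳ-≤ (9 ^ d) (cube-mono 3^r≤n) ⟩
  9 ^ d * cube n                    ∎)
  where
  open ≤-Reasoning
  d = 8 * 3 ^ c
  swap : ∀ a b c → a * b * c ≡ a * c * b
  swap = solve-∀

-- Lower bound for b(a3ᵏ+1)3^ℓ

module Minimality
  (a b c : ℕ) (1≤a : 1 ≤ a) (1≤b : 1 ≤ b)
  (ab≡c : ‖ a * b ‖≡ c) (stable : Stable (a * b))
  where

  open ≤-Reasoning

  -- If N = M 3ʲ lies below Q, the error is at least the smaller of 3ʲ and 3^(k+ℓ). The term `T`
  -- rules out the first, as M ≤ T; the term `a * b` rules out the second.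
  F : ℕ → ℕ
  F T = T + a * b

  B : ℕ
  B = proj₁ (approximable (8 * 3 ^ c) F)

  -- Ensures that `b`, `B * 3 ^ b` and `B * b` are all below 3ᵏ.
  threshold : ℕ
  threshold = b + (B * 3 ^ b + B * b)

  module _ (k ℓ : ℕ) (K≤k : threshold ≤ k) where

    Q : ℕ
    Q = a * b * 3 ^ (k + ℓ)

    b≤k : b ≤ k
    b≤k = ≤-trans (m≤m+n b _) K≤k

    below-3^k : ∀ {u} → u ≤ k → u < 3 ^ k
    below-3^k u≤k = ≤-<-trans u≤k (n<3^n k)

    B3^b<3^k : B * 3 ^ b < 3 ^ k
    B3^b<3^k = below-3^k (≤-trans (m≤m+n _ (B * b)) (≤-trans (m≤n+m _ b) K≤k))

    Bb<3^k : B * b < 3 ^ k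
    Bb<3^k = below-3^k (≤-trans (m≤n+m (B * b) (B * 3 ^ b)) (≤-trans (m≤n+m _ b) K≤k))

    3^k3^ℓ≤Q : 3 ^ k * 3 ^ ℓ ≤ Q
    3^k3^ℓ≤Q = begin
      3 ^ k * 3 ^ ℓ        ≡⟨ ^-distribˡ-+-* 3 k ℓ ⟨
      3 ^ (k + ℓ)          ≤⟨ m≤n*m (3 ^ (k + ℓ)) (a * b) {{>-nonZero (*-mono-≤ 1≤a 1≤b)}} ⟩
      Q                    ∎

    -- 3 ^ (ℓ + b) divides Q and exceeds b * 3 ^ ℓ, so it does not divide the sum.
    not-small-multiple : ∀ {M j} → M ≤ B → ¬ (Q + b * 3 ^ ℓ ≡ M * 3 ^ j)
    not-small-multiple {M} {j} M≤B eq with ≤-total (ℓ + b) j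
    ... | inj₁ ℓ+b≤j = <⇒≱ (n<3^n b) (*-cancelʳ-≤ _ _ (3 ^ ℓ) {{m^n≢0 3 ℓ}} (begin
      3 ^ b * 3 ^ ℓ   ≡⟨ *-comm (3 ^ b) (3 ^ ℓ) ⟩
      3 ^ ℓ * 3 ^ b   ≡⟨ ^-distribˡ-+-* 3 ℓ b ⟨
      3 ^ (ℓ + b)     ≤⟨ ∣⇒≤ {{>-nonZero (*-mono-≤ 1≤b (m^n>0 3 ℓ))}} (∣m+n∣m⇒∣n
                          (subst (3 ^ (ℓ + b) ∣_) (sym eq) (3^∣ M ℓ+b≤j))
                          (3^∣ (a * b) (subst (ℓ + b ≤_) (+-comm ℓ k) (+-monoʳ-≤ ℓ b≤k)))) ⟩
      b * 3 ^ ℓ       ∎))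
    -- For small `j` the number M 3ʲ stays below 3^(k+ℓ), hence below Q.
    ... | inj₂ j≤ℓ+b = <⇒≱ B3^b<3^k (*-cancelʳ-≤ _ _ (3 ^ ℓ) {{m^n≢0 3 ℓ}} (begin
      3 ^ k * 3 ^ ℓ           ≤⟨ 3^k3^ℓ≤Q ⟩
      Q                       ≤⟨ m≤m+n Q (b * 3 ^ ℓ) ⟩
      Q + b * 3 ^ ℓ           ≡⟨ eq ⟩
      M * 3 ^ j               ≤⟨ *-mono-≤ M≤B (^-monoʳ-≤ 3 j≤ℓ+b) ⟩
      B * 3 ^ (ℓ + b)         ≡⟨ cong (λ i → B * 3 ^ i) (+-comm ℓ b) ⟩
      B * 3 ^ (b + ℓ)         ≡⟨ cong (B *_) (^-distribˡ-+-* 3 b ℓ) ⟩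
      B * (3 ^ b * 3 ^ ℓ)     ≡⟨ *-assoc B (3 ^ b) (3 ^ ℓ) ⟨
      B * 3 ^ b * 3 ^ ℓ       ∎))

    -- Distinct integers N and Q differ by at least 3 ^ min(j , k + ℓ); here they are too close for that.
    approximant≡Q : ∀ {T M j x} → T ≤ B → M ≤ T → Q + b * 3 ^ ℓ ≡ M * 3 ^ j + x →
      suc (F T) * x ≤ M * 3 ^ j → M * 3 ^ j ≡ Q
    approximant≡Q {T} {M} {j} {x} T≤B M≤T eq small with <-cmp (M * 3 ^ j) Q
    ... | tri≈ _ N≡Q _ = N≡Q
    ... | tri< N<Q _ _ = contradiction N<Q (≤⇒≯ (close (≤-total j (k + ℓ))))
      where
      N = M * 3 ^ j
      t≤x : ∀ {t} → N + t ≤ Q → t ≤ x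
      t≤x {t} N+t≤Q = +-cancelˡ-≤ N _ _ (begin
        N + t            ≤⟨ N+t≤Q ⟩
        Q                ≤⟨ m≤m+n Q (b * 3 ^ ℓ) ⟩
        Q + b * 3 ^ ℓ    ≡⟨ eq ⟩
        N + x            ∎)
      close : j ≤ k + ℓ ⊎ k + ℓ ≤ j → Q ≤ N
      close (inj₁ j≤) = contradiction
        (*-cancelʳ-≤ (suc (F T)) M (3 ^ j) {{m^n≢0 3 j}}
          (≤-trans (*-monoʳ-≤ (suc (F T)) (t≤x (gap (3^∣ M {j} ≤-refl) (3^∣ (a * b) j≤) N<Q))) small))
        (<⇒≱ (s≤s (≤-trans M≤T (m≤m+n T (a * b)))))
      close (inj₂ ≤j) = ≤-trans (*-monoˡ-≤ (3 ^ (k + ℓ)) (≤-trans (m≤n+m (a * b) T) (n≤1+n _)))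
        (≤-trans (*-monoʳ-≤ (suc (F T))
          (t≤x (gap (3^∣ M ≤j) (3^∣ (a * b) {k + ℓ} ≤-refl) N<Q))) small)
    -- Now N lies between Q and Q + b3^ℓ, so the gap is at most b3^ℓ; the size of `k`, not the
    -- precision, excludes this.
    ... | tri> _ _ Q<N = contradiction (close (≤-total j (k + ℓ))) (<⇒≱ Bb<3^k)
      where
      N = M * 3 ^ j
      t≤ : ∀ {t} → Q + t ≤ N → t ≤ b * 3 ^ ℓ
      t≤ {t} Q+t≤N = +-cancelˡ-≤ Q _ _ (begin
        Q + t            ≤⟨ Q+t≤N ⟩
        N                ≤⟨ m≤m+n N x ⟩
        N + x            ≡⟨ eq ⟨
        Q + b * 3 ^ ℓ    ∎)
      close : j ≤ k + ℓ ⊎ k + ℓ ≤ j → 3 ^ k ≤ B * b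
      close (inj₁ j≤) = *-cancelʳ-≤ _ _ (3 ^ ℓ) {{m^n≢0 3 ℓ}} (begin
        3 ^ k * 3 ^ ℓ       ≤⟨ 3^k3^ℓ≤Q ⟩
        Q                   ≤⟨ <⇒≤ Q<N ⟩
        M * 3 ^ j           ≤⟨ *-mono-≤ (≤-trans M≤T T≤B)
                                (t≤ (gap (3^∣ (a * b) j≤) (3^∣ M {j} ≤-refl) Q<N)) ⟩
        B * (b * 3 ^ ℓ)     ≡⟨ *-assoc B b (3 ^ ℓ) ⟨
        B * b * 3 ^ ℓ       ∎)
      close (inj₂ ≤j) = contradiction
        (*-cancelʳ-≤ _ _ (3 ^ ℓ) {{m^n≢0 3 ℓ}} (≤-trans
          (≤-reflexive (sym (^-distribˡ-+-* 3 k ℓ)))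
          (t≤ (gap (3^∣ (a * b) {k + ℓ} ≤-refl) (3^∣ M ≤j) Q<N))))
        (<⇒≱ (below-3^k b≤k))

    -- Stability enters here, with exponent `k + ℓ`.
    ones-Q : ∀ e → eval e ≡ Q → 3 * (k + ℓ) + c ≤ ones e
    ones-Q e e≡Q = proj₂ (stable (k + ℓ) c ab≡c) e (trans e≡Q (*-comm (a * b) (3 ^ (k + ℓ))))

    minimal : ∀ e → eval e ≡ Q + b * 3 ^ ℓ → 3 * (k + ℓ) + c < ones e
    minimal e e≡n = ≰⇒> λ few → excluded few (proj₂ (approximable (8 * 3 ^ c) F) e (dense few))
      where
      dense : ones e ≤ 3 * (k + ℓ) + c → Dense (8 * 3 ^ c) (eval e) (ones e)
      dense few = dense-above c {k + ℓ}
        (begin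
          3 ^ (k + ℓ)       ≡⟨ ^-distribˡ-+-* 3 k ℓ ⟩
          3 ^ k * 3 ^ ℓ     ≤⟨ 3^k3^ℓ≤Q ⟩
          Q                 ≤⟨ m≤m+n Q (b * 3 ^ ℓ) ⟩
          Q + b * 3 ^ ℓ     ≡⟨ e≡n ⟨
          eval e            ∎)
        (subst (ones e ≤_) (+-comm (3 * (k + ℓ)) c) few)
      excluded : ones e ≤ 3 * (k + ℓ) + c → ¬ Approx F B (eval e) (ones e)
      excluded few A = cases (saving A)
        where
        n≡N+x : Q + b * 3 ^ ℓ ≡ M A * 3 ^ j A + x A
        n≡N+x = trans (sym e≡n) (trans (excess A) (cong (_+ x A) (value A)))
        cases : ¬ (x A ≡ 0 ⊎ ones (expr A) < ones e)
        cases (inj₁ x≡0) = not-small-multiple {M A} {j A} (≤-trans (M≤T A) (T≤B A))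
          (trans n≡N+x (trans (cong (M A * 3 ^ j A +_) x≡0) (+-identityʳ _)))
        cases (inj₂ fewer) = <⇒≱ (<-≤-trans fewer few) (ones-Q (expr A)
          (trans (value A) (approximant≡Q {M = M A} {j A} (T≤B A) (M≤T A) n≡N+x
            (subst (suc (F (T A)) * x A ≤_) (value A) (small A)))))

  lower-bound : ∀ k ℓ → threshold ≤ k → ∀ e → eval e ≡ b * ((a * 3 ^ k + 1) * 3 ^ ℓ) →
    c + 3 * k + 3 * ℓ + 1 ≤ ones e
  lower-bound k ℓ K≤k e eq = subst (_≤ ones e) (count c k ℓ) (minimal k ℓ K≤k e (trans eq (begin-equality
    b * ((a * 3 ^ k + 1) * 3 ^ ℓ)           ≡⟨ expand a b (3 ^ k) (3 ^ ℓ) ⟩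
    a * b * (3 ^ k * 3 ^ ℓ) + b * 3 ^ ℓ     ≡⟨ cong (λ t → a * b * t + b * 3 ^ ℓ) (^-distribˡ-+-* 3 k ℓ) ⟨
    a * b * 3 ^ (k + ℓ) + b * 3 ^ ℓ         ∎)))
    where
    expand : ∀ a b u v → b * ((a * u + 1) * v) ≡ a * b * (u * v) + b * v
    expand = solve-∀
    count : ∀ c k ℓ → 1 + (3 * (k + ℓ) + c) ≡ c + 3 * k + 3 * ℓ + 1
    count = solve-∀

-- Upper bound and conclusion

Writable : ℕ → ℕ → Set
Writable n s = Σ Expr (λ e → eval e ≡ n × ones e ≡ s)

writable-*3^ : ∀ {n s} k → Writable n s → Writable (n * 3 ^ k) (s + 3 * k)
writable-*3^ {n} {s} zero (e , p , q) = e , trans p (sym (*-identityʳ n)) , trans q (sym (+-identityʳ s))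
writable-*3^ {n} {s} (suc k) w with writable-*3^ k w
... | e , p , q = e ⊗ ((one ⊕ one) ⊕ one) ,
  trans (cong (_* 3) p) (regroup n (3 ^ k)) , trans (cong (_+ 3) q) (count s k)
  where
  regroup : ∀ n t → n * t * 3 ≡ n * (3 * t)
  regroup = solve-∀
  count : ∀ s k → s + 3 * k + 3 ≡ s + 3 * (1 + k)
  count = solve-∀

writable-* : ∀ {m n s t} → Writable m s → Writable n t → Writable (m * n) (s + t)
writable-* (e , p , q) (f , p′ , q′) = e ⊗ f , cong₂ _*_ p p′ , cong₂ _+_ q q′

writable-suc : ∀ {n s} → Writable n s → Writable (n + 1) (s + 1)
writable-suc (e , p , q) = e ⊕ one , cong (_+ 1) p , cong (_+ 1) q

writable-a3^k+1 : ∀ {a s} k ℓ → Writable a s →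
  Writable ((a * 3 ^ k + 1) * 3 ^ ℓ) (s + 3 * k + 3 * ℓ + 1)
writable-a3^k+1 {a} {s} k ℓ w = subst (Writable _) (count (s + 3 * k) (3 * ℓ))
  (writable-*3^ ℓ (writable-suc (writable-*3^ k w)))
  where
  count : ∀ u v → u + 1 + v ≡ u + v + 1
  count = solve-∀

theorem1p4 : ((a ca : ℕ) → 1 ≤ a → ‖ a ‖≡ ca → Stable a →
    Σ ℕ (λ K → (k ℓ : ℕ) → K ≤ k →
    ‖ (a * 3 ^ k + 1) * 3 ^ ℓ ‖≡ (ca + 3 * k + 3 * ℓ + 1)))
    ×
    ((a b ca cb : ℕ) → 1 ≤ a → 1 ≤ b → ‖ a ‖≡ ca → ‖ b ‖≡ cb →
    Stable (a * b) → ‖ a * b ‖≡ (ca + cb) →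
    Σ ℕ (λ K → (k ℓ : ℕ) → K ≤ k →
    ‖ b * ((a * 3 ^ k + 1) * 3 ^ ℓ) ‖≡ (ca + cb + 3 * k + 3 * ℓ + 1)))
theorem1p4 = part₁ , part₂
  where
  part₁ : ∀ a ca → 1 ≤ a → ‖ a ‖≡ ca → Stable a →
    Σ ℕ (λ K → (k ℓ : ℕ) → K ≤ k → ‖ (a * 3 ^ k + 1) * 3 ^ ℓ ‖≡ (ca + 3 * k + 3 * ℓ + 1))
  part₁ a ca 1≤a ‖a‖ stable = threshold , λ k ℓ K≤k →
    writable-a3^k+1 k ℓ (proj₁ ‖a‖) ,
    λ e eq → lower-bound k ℓ K≤k e (trans eq (sym (*-identityˡ _)))
    where
    -- The lower bound is the case `b = 1`; the upper bound is written without the factor 1, which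
    -- would cost an extra one.
    open Minimality a 1 ca 1≤a ≤-refl
      (subst (‖_‖≡ ca) (sym (*-identityʳ a)) ‖a‖) (subst Stable (sym (*-identityʳ a)) stable)

  part₂ : ∀ a b ca cb → 1 ≤ a → 1 ≤ b → ‖ a ‖≡ ca → ‖ b ‖≡ cb →
    Stable (a * b) → ‖ a * b ‖≡ (ca + cb) →
    Σ ℕ (λ K → (k ℓ : ℕ) → K ≤ k →
      ‖ b * ((a * 3 ^ k + 1) * 3 ^ ℓ) ‖≡ (ca + cb + 3 * k + 3 * ℓ + 1))
  part₂ a b ca cb 1≤a 1≤b ‖a‖ ‖b‖ stable ‖ab‖ = threshold , λ k ℓ K≤k →
    subst (Writable _) (count ca cb (3 * k) (3 * ℓ))
      (writable-* (proj₁ ‖b‖) (writable-a3^k+1 k ℓ (proj₁ ‖a‖))) ,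
    lower-bound k ℓ K≤k
    where
    open Minimality a b (ca + cb) 1≤a 1≤b ‖ab‖ stable
    count : ∀ p q u v → q + (p + u + v + 1) ≡ p + q + u + v + 1
    count = solve-∀
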